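{- There exist a finite simple graph $G$ with exactly $14$ vertices and list chromatic number equal to $3$, and a $2$-list assignment $L$ of $G$, such that at most $9$ vertices of $G$ can be properly coloured from $L$; that is, for every set $S\subseteq V(G)$ and every function $f:S\to\bigcup_{v\in V(G)}L(v)$ satisfying $f(v)\in L(v)$ for all $v\in S$ and $f(u)\neq f(v)$ for every edge $uv$ of $G$ with $u,v\in S$, we have $|S|\leq 9$.
   Context: Graphs are finite, simple and undirected. For a positive integer $k$, a $k$-list assignment of a graph $G$ is a function $L$ assigning to each vertex $v\in V(G)$ a set $L(v)$ of exactly $k$ colours (colours may be taken to be natural numbers). A proper $L$-colouring of $G$ is a function $f$ on $V(G)$ with $f(v)\in L(v)$ for every $v\in V(G)$ and $f(u)\neq f(v)$ for every edge $uv\in E(G)$. The list chromatic number of $G$ is the least positive integer $k$ such that for every $k$-list assignment $L$ of $G$ there exists a proper $L$-colouring of $G$. A set $S\subseteq V(G)$ of vertices can be properly coloured from $L$ if the induced subgraph $G[S]$ has a proper colouring in which each vertex $v\in S$ receives a colour from $L(v)$. -}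

module Defs where

open import Data.Fin.Base using (Fin)
open import Data.Fin.Subset using (Subset; _∈_)
open import Data.Nat.Base using (ℕ; _≤_)
open import Data.Product.Base using (Σ; ∃; _×_; proj₁)
open import Data.Vec.Base using (Vec)
open import Data.Vec.Membership.Propositional using () renaming (_∈_ to _∈ᵛ_)
open import Data.Vec.Relation.Unary.Unique.Propositional using (Unique)
open import Function.Base using (_on_)
open import Level using (0ℓ)
open import Relation.Binary.Core using (Rel)
open import Relation.Binary.Definitions using (Decidable; Symmetric)
open import Relation.Binary.PropositionalEquality.Core using (_≢_)
open import Relation.Nullary.Negation.Core using (¬_)

-- Simple undirected graphs.  The vertex type is a parameter so that an induced
-- subgraph is again a graph; finiteness comes from taking V to be Fin n, or the
-- type of elements of a Subset n.
record Graph (V : Set) : Set₁ where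
  field
    _~_    : Rel V 0ℓ
    ~-sym  : Symmetric _~_
    ~-irr  : ∀ {v} → ¬ (v ~ v)
    _~?_   : Decidable _~_

-- Since v ∈ S has at most one proof, this type has exactly ∣ S ∣ elements.
Elements : ∀ {n} → Subset n → Set
Elements S = ∃ λ v → v ∈ S

_[_] : ∀ {n} → Graph (Fin n) → (S : Subset n) → Graph (Elements S)
G [ S ] = record
  { _~_   = _~_ on proj₁
  ; ~-sym = ~-sym
  ; ~-irr = ~-irr
  ; _~?_  = λ u v → proj₁ u ~? proj₁ v
  }
  where open Graph G

-- A set of exactly k colours, presented by an enumeration without repetition;
-- only membership is ever used, so the order of the enumeration is irrelevant.
ColourSet : ℕ → Set
ColourSet k = Σ (Vec ℕ k) Unique

infix 4 _∈ᶜ_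

_∈ᶜ_ : ∀ {k} → ℕ → ColourSet k → Set
c ∈ᶜ C = c ∈ᵛ proj₁ C

ListAssignment : Set → ℕ → Set
ListAssignment V k = V → ColourSet k

IsProperColouring : ∀ {V k} → Graph V → ListAssignment V k → (V → ℕ) → Set
IsProperColouring G L f =
  (∀ v → f v ∈ᶜ L v) × (∀ u v → u ~ v → f u ≢ f v)
  where open Graph G

restrict : ∀ {n k} → ListAssignment (Fin n) k →
           (S : Subset n) → ListAssignment (Elements S) k
restrict L S v = L (proj₁ v)

Choosable : ∀ {V} → Graph V → ℕ → Set
Choosable {V} G k = (L : ListAssignment V k) → ∃ λ f → IsProperColouring G L f

IsListChromaticNumber : ∀ {V} → Graph V → ℕ → Set
IsListChromaticNumber G k =
  1 ≤ k × Choosable G k × (∀ j → 1 ≤ j → Choosable G j → k ≤ j)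

{-# OPTIONS --safe #-}

-- G consists of four triangles 2-4, 5-7, 8-10 and 11-13, two hubs 0 and 1, each
-- with neighbours in all four triangles, and the edges 6-10 and 6-12.
--
-- Choosability: let a and b be colours of the hubs.  A vertex adjacent to both hubs
-- loses two colours from its list X only if a ≠ b both lie in X, and when the two
-- hub lists are disjoint this happens for at most 2 of the 9 pairs (a , b).  Hence
-- some pair is harmless for the four vertices 2, 5, 8 and 11 simultaneously, and
-- from there a greedy colouring of the other vertices succeeds.
--
-- In badLists the vertices of a triangle share one list of two colours, so every
-- triangle loses a vertex; an exhaustive search shows that a fifth vertex is lost.
module Submission where

open import Defs
open import Data.Empty using (⊥)
open import Data.Fin using (Fin; zero; suc; #_)
open import Data.Fin.Properties using () renaming (_≟_ to _≟ᶠ_)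
open import Data.Fin.Subset using (Subset; ∣_∣; inside; outside) renaming (⊤ to full)
open import Data.Fin.Subset.Properties using (∣p∣≤n)
open import Data.List.Base using (List; []; _∷_; length; map; filter; concatMap; cartesianProduct)
open import Data.List.Membership.DecPropositional using () renaming (_∈?_ to mem?)
open import Data.List.Membership.Propositional using (find) renaming (_∈_ to _∈ˡ_; _∉_ to _∉ˡ_)
open import Data.List.Membership.Propositional.Properties
  using (∈-filter⁺; ∈-cartesianProduct⁺; ∈-cartesianProduct⁻; ∈-concatMap⁺)
open import Data.List.Properties using (length-++; length-map; filter-notAll)
open import Data.List.Relation.Unary.All as All using (All; []; _∷_; all?)
open import Data.List.Relation.Unary.All.Properties using (¬Any⇒All¬)
open import Data.List.Relation.Unary.Any as Any using (Any; here; there; any?)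
open import Data.List.Relation.Unary.AllPairs using ([]; _∷_)
open import Data.List.Relation.Unary.Unique.Propositional using () renaming (Unique to Uniqueˡ)
import Data.List.Relation.Unary.Unique.Propositional.Properties as Uniqueˡ
open import Data.Nat.Base using (ℕ; zero; suc; _+_; _*_; _≤_; _<_; z≤n; s≤s; s≤s⁻¹)
open import Data.Nat.Properties
  using ( _≟_; _≤?_; ≤-refl; ≤-reflexive; ≤-trans; ≮⇒≥; 1+n≰n; m≤n⇒m≤1+n; n≤0⇒n≡0; module ≤-Reasoning
        ; +-suc; +-identityʳ; +-mono-≤; +-monoˡ-≤; *-monoˡ-≤; *-zeroʳ; m+n≡0⇒n≡0 )
open import Data.Product.Base using (Σ; ∃; ∃₂; _×_; _,_; proj₁; proj₂)
open import Data.Product.Properties using (≡-dec)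
open import Data.Sum.Base using (_⊎_; inj₁; inj₂; swap; [_,_]′)
open import Data.Unit.Base using (⊤; tt)
open import Data.Vec.Base using (Vec; []; _∷_; here; there; toList; allFin) renaming (lookup to lookupᵛ)
open import Data.Vec.Membership.Propositional.Properties using (∈-toList⁺; ∈-toList⁻)
open import Data.Vec.Properties using (length-toList; lookup-allFin)
open import Data.Vec.Relation.Unary.All using ([]; _∷_) renaming (All to Allᵛ)
open import Data.Vec.Relation.Unary.All.Properties using (tabulate⁻; toList⁺)
open import Data.Vec.Relation.Unary.AllPairs using ([]; _∷_)
open import Data.Vec.Relation.Unary.Any using (here; there)
  renaming (Any to Anyᵛ; any? to anyᵛ?; map to mapᵛ)
open import Data.Vec.Relation.Unary.Unique.Propositional using (Unique)
open import Function.Base using (id; _∘_)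
open import Level using (0ℓ)
open import Relation.Binary.Definitions using (DecidableEquality)
open import Relation.Binary.PropositionalEquality
  using (_≡_; _≢_; refl; sym; trans; cong₂; subst; subst₂; ≢-sym)
open import Relation.Nullary.Decidable
  using (Dec; yes; no; True; toWitness; ¬?; _×-dec_; _⊎-dec_; from-yes; from-no)
open import Relation.Nullary.Negation using (¬_; contradiction)
open import Relation.Unary using (Pred; Decidable)

-- Pigeonhole and counting for lists.

module _ {A : Set} (_≟_ : DecidableEquality A) where

  private
    infix 4 _∈?_
    _∈?_ = mem? _≟_

  -- Pigeonhole by induction on `xs`: if the head `x` occurs in `ys`, deleting all its copies
  -- shortens `ys`, and the element found in the tail differs from `x` by uniqueness. Repetitions in
  -- `ys` do no harm.
  fresh : ∀ {xs} ys → Uniqueˡ xs → length ys < length xs → ∃ λ x → x ∈ˡ xs × x ∉ˡ ys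
  fresh {x ∷ xs} ys (x≢xs ∷ xs!) ∣ys∣<∣xs∣ with x ∈? ys
  ... | no  x∉ys = x , here refl , x∉ys
  ... | yes x∈ys = z , there z∈xs , λ z∈ys → z∉ (∈-filter⁺ ≢x? z∈ys (≢-sym (All.lookup x≢xs z∈xs)))
    where
    ≢x? : Decidable (_≢ x)
    ≢x? y = ¬? (y ≟ x)

    rec = fresh (filter ≢x? ys) xs!
      (≤-trans (filter-notAll ≢x? ys (Any.map (λ x≡y y≢x → y≢x (sym x≡y)) x∈ys)) (s≤s⁻¹ ∣ys∣<∣xs∣))
    z    = proj₁ rec
    z∈xs = proj₁ (proj₂ rec)
    z∉   = proj₂ (proj₂ rec)

length-cartesianProduct : ∀ {A B : Set} (xs : List A) (ys : List B) →
                          length (cartesianProduct xs ys) ≡ length xs * length ys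
length-cartesianProduct []       ys = refl
length-cartesianProduct (x ∷ xs) ys = trans (length-++ (map (x ,_) ys))
  (cong₂ _+_ (length-map (x ,_) ys) (length-cartesianProduct xs ys))

length-concatMap-≤ : ∀ {A B : Set} (f : A → List B) m → (∀ x → length (f x) ≤ m) →
                     ∀ xs → length (concatMap f xs) ≤ length xs * m
length-concatMap-≤ f m ∣f∣≤m []       = z≤n
length-concatMap-≤ f m ∣f∣≤m (x ∷ xs) = ≤-trans (≤-reflexive (length-++ (f x)))
  (+-mono-≤ (∣f∣≤m x) (length-concatMap-≤ f m ∣f∣≤m xs))

length-filter-disjoint : ∀ {A : Set} {P Q : Pred A 0ℓ} (P? : Decidable P) (Q? : Decidable Q) →
                         (∀ {x} → P x → ¬ Q x) → ∀ xs →
                         length (filter P? xs) + length (filter Q? xs) ≤ length xs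
length-filter-disjoint P? Q? P∩Q=∅ [] = z≤n
length-filter-disjoint P? Q? P∩Q=∅ (x ∷ xs)
  with P? x | Q? x | length-filter-disjoint P? Q? P∩Q=∅ xs
... | yes p | yes q | _  = contradiction q (P∩Q=∅ p)
... | yes _ | no  _ | ih = s≤s ih
... | no  _ | yes _ | ih = ≤-trans (≤-reflexive (+-suc _ _)) (s≤s ih)
... | no  _ | no  _ | ih = m≤n⇒m≤1+n ih

-- Integrality matters here: over the reals the maximum would be 9/4, and four times that is no
-- longer below 9.
m+n≤3⇒m*n≤2 : ∀ m n → m + n ≤ 3 → m * n ≤ 2
m+n≤3⇒m*n≤2 0 n _ = z≤n
m+n≤3⇒m*n≤2 1 n (s≤s n≤2) = ≤-trans (≤-reflexive (+-identityʳ n)) n≤2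
m+n≤3⇒m*n≤2 2 0 _ = z≤n
m+n≤3⇒m*n≤2 2 1 _ = ≤-refl
m+n≤3⇒m*n≤2 2 (suc (suc n)) (s≤s (s≤s (s≤s ())))
m+n≤3⇒m*n≤2 (suc (suc (suc m))) n (s≤s (s≤s (s≤s m+n≤0)))
  rewrite m+n≡0⇒n≡0 m (n≤0⇒n≡0 m+n≤0) | *-zeroʳ m = z≤n

-- Avoiding colours, and harmless pairs of hub colours.

infix 4 _∈ˡ?_
_∈ˡ?_ = mem? _≟_

colours : ∀ {k} → ColourSet k → List ℕ
colours C = toList (proj₁ C)

∣colours∣ : ∀ {k} (C : ColourSet k) → length (colours C) ≡ k
∣colours∣ C = length-toList (proj₁ C)

toList-unique : ∀ {A : Set} {k} {xs : Vec A k} → Unique xs → Uniqueˡ (toList xs)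
toList-unique []           = []
toList-unique (x≢xs ∷ xs!) = toList⁺ x≢xs ∷ toList-unique xs!

-- Deleting a and b removes at most one colour from X.
infix 4 _∥_⟨_⟩
_∥_⟨_⟩ : ∀ {k} → ℕ → ℕ → ColourSet k → Set
a ∥ b ⟨ X ⟩ = a ≡ b ⊎ ¬ (a ∈ˡ colours X × b ∈ˡ colours X)

avoid : ∀ {k} (C : ColourSet k) ys → length ys < k → ∃ λ c → c ∈ᶜ C × c ∉ˡ ys
avoid C ys ∣ys∣<k =
  let c , c∈C , c∉ys = fresh _≟_ ys (toList-unique (proj₂ C))
                         (subst (length ys <_) (sym (∣colours∣ C)) ∣ys∣<k)
  in  c , ∈-toList⁻ c∈C , c∉ys

avoid₂ : (C : ColourSet 3) (a b : ℕ) → ∃ λ c → c ∈ᶜ C × a ≢ c × b ≢ c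
avoid₂ C a b =
  let c , c∈C , c∉ = avoid C (a ∷ b ∷ []) ≤-refl
  in  c , c∈C , (λ a≡c → c∉ (here (sym a≡c))) , (λ b≡c → c∉ (there (here (sym b≡c))))

-- Either `a` and `b` coincide or one of them is absent from `C`, so only two of the three forbidden
-- colours have to be avoided actively.
avoid₃ : (C : ColourSet 3) (a b d : ℕ) → a ∥ b ⟨ C ⟩ →
         ∃ λ c → c ∈ᶜ C × a ≢ c × b ≢ c × d ≢ c
avoid₃ C a .a d (inj₁ refl) =
  let c , c∈C , a≢c , d≢c = avoid₂ C a d in c , c∈C , a≢c , a≢c , d≢c
avoid₃ C a b d (inj₂ ¬both) with a ∈ˡ? colours C
... | yes a∈C = let c , c∈C , a≢c , d≢c = avoid₂ C a d
                in  c , c∈C , a≢c , (λ { refl → ¬both (a∈C , ∈-toList⁺ c∈C) }) , d≢c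
... | no  a∉C = let c , c∈C , b≢c , d≢c = avoid₂ C b d
                in  c , c∈C , (λ { refl → a∉C (∈-toList⁺ c∈C) }) , b≢c , d≢c

module _ (P Q : ColourSet 3) where

  -- For disjoint `P` and `Q` these are exactly the pairs of hub colours that violate `a ∥ b ⟨ X ⟩`.
  blockedPairs : ColourSet 3 → List (ℕ × ℕ)
  blockedPairs X = cartesianProduct (filter (_∈ˡ? colours P) (colours X))
                                    (filter (_∈ˡ? colours Q) (colours X))

  -- The colours of `X` in `P` and those in `Q` form disjoint parts of a set of size 3, and the
  -- pairs are the product of these parts.
  ∣blockedPairs∣≤2 : (∀ {x} → x ∈ˡ colours P → x ∉ˡ colours Q) → ∀ X → length (blockedPairs X) ≤ 2
  ∣blockedPairs∣≤2 P∩Q=∅ X = ≤-trans (≤-reflexive (length-cartesianProduct XP XQ))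
    (m+n≤3⇒m*n≤2 (length XP) (length XQ) (≤-trans
      (length-filter-disjoint (_∈ˡ? colours P) (_∈ˡ? colours Q) P∩Q=∅ (colours X))
      (≤-reflexive (∣colours∣ X))))
    where
    XP = filter (_∈ˡ? colours P) (colours X)
    XQ = filter (_∈ˡ? colours Q) (colours X)

  -- A colour common to `P` and `Q` can serve both hubs. Otherwise at most 4 * 2 of the 3 * 3 pairs
  -- are blocked, so `fresh` finds one that is not.
  harmlessPair : ∀ Xs → length Xs ≤ 4 →
                 ∃₂ λ a b → a ∈ᶜ P × b ∈ᶜ Q × All (a ∥ b ⟨_⟩) Xs
  harmlessPair Xs ∣Xs∣≤4 with any? (_∈ˡ? colours Q) (colours P)
  ... | yes common =
    let a , a∈P , a∈Q = find common
    in  a , a , ∈-toList⁻ a∈P , ∈-toList⁻ a∈Q , All.universal (λ _ → inj₁ refl) Xs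
  ... | no ¬common =
    let (a , b) , ab∈ , ab∉ = fresh (≡-dec _≟_ _≟_) (concatMap blockedPairs Xs)
          (Uniqueˡ.cartesianProduct⁺ (toList-unique (proj₂ P)) (toList-unique (proj₂ Q))) fewBlocked
        a∈P , b∈Q = ∈-cartesianProduct⁻ (colours P) (colours Q) ab∈
    in  a , b , ∈-toList⁻ a∈P , ∈-toList⁻ b∈Q
      , All.map (λ ab∉X → inj₂ λ (a∈X , b∈X) → ab∉X
          (∈-cartesianProduct⁺ (∈-filter⁺ (_∈ˡ? colours P) a∈X a∈P) (∈-filter⁺ (_∈ˡ? colours Q) b∈X b∈Q)))
          (¬Any⇒All¬ Xs (ab∉ ∘ ∈-concatMap⁺ blockedPairs))
    where
    P∩Q=∅ : ∀ {x} → x ∈ˡ colours P → x ∉ˡ colours Q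
    P∩Q=∅ = All.lookup (¬Any⇒All¬ (colours P) ¬common)

    fewBlocked : length (concatMap blockedPairs Xs) < length (cartesianProduct (colours P) (colours Q))
    fewBlocked = begin-strict
      length (concatMap blockedPairs Xs)
        ≤⟨ length-concatMap-≤ blockedPairs 2 (∣blockedPairs∣≤2 P∩Q=∅) Xs ⟩
      length Xs * 2                                      ≤⟨ *-monoˡ-≤ 2 ∣Xs∣≤4 ⟩
      8                                                  <⟨ ≤-refl ⟩
      9                                                  ≡⟨ cong₂ _*_ (∣colours∣ P) (∣colours∣ Q) ⟨
      length (colours P) * length (colours Q)            ≡⟨ length-cartesianProduct (colours P) (colours Q) ⟨
      length (cartesianProduct (colours P) (colours Q))  ∎
      where open ≤-Reasoning

-- Exhaustive search for partial colourings.

module Search {V : Set} {c} (G : Graph V) (L : ListAssignment V c) where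
  open Graph G

  Compatible : List (V × ℕ) → V → ℕ → Set
  Compatible A v x = All (λ (u , y) → ¬ (x ≡ y × u ~ v)) A

  compatible? : ∀ A v x → Dec (Compatible A v x)
  compatible? A v x = all? (λ (u , y) → ¬? (x ≟ y ×-dec u ~? v)) A

  -- The partial colouring A extends to all but at most ℓ of the vertices in vs.
  Extendable : List V → ℕ → List (V × ℕ) → Set
  Skippable  : List V → ℕ → List (V × ℕ) → Set
  Extendable []       ℓ A = ⊤
  Extendable (v ∷ vs) ℓ A =
    Anyᵛ (λ x → Compatible A v x × Extendable vs ℓ ((v , x) ∷ A)) (proj₁ (L v)) ⊎ Skippable vs ℓ A
  Skippable vs zero    A = ⊥
  Skippable vs (suc ℓ) A = Extendable vs ℓ A

  extendable? : ∀ vs ℓ A → Dec (Extendable vs ℓ A)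
  skippable?  : ∀ vs ℓ A → Dec (Skippable vs ℓ A)
  extendable? []       ℓ A = yes tt
  extendable? (v ∷ vs) ℓ A =
    anyᵛ? (λ x → compatible? A v x ×-dec extendable? vs ℓ ((v , x) ∷ A)) (proj₁ (L v)) ⊎-dec skippable? vs ℓ A
  skippable? vs zero    A = no λ ()
  skippable? vs (suc ℓ) A = extendable? vs ℓ A

  -- Completeness of the search: a colouring of `S` traces a successful branch, using its own colour
  -- at a vertex in `S` and spending one allowed loss at a vertex outside. Indexing by positions in
  -- `vs` lets `vs` and `S` be peeled together, while `A` remembers the vertices already passed.
  extend : ∀ {n} (vs : Vec V n) ℓ A (S : Subset n) (f : Elements S → ℕ) →
           (∀ i → f i ∈ᶜ L (lookupᵛ vs (proj₁ i))) →
           (∀ i j → lookupᵛ vs (proj₁ i) ~ lookupᵛ vs (proj₁ j) → f i ≢ f j) →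
           (∀ i → Compatible A (lookupᵛ vs (proj₁ i)) (f i)) →
           n ≤ ∣ S ∣ + ℓ → Extendable (toList vs) ℓ A
  extend [] ℓ A S f f∈L proper compatible n≤ = tt
  extend (v ∷ vs) ℓ A (inside ∷ S) f f∈L proper compatible (s≤s n≤) =
    inj₁ (mapᵛ (λ { refl → compatible 0ᵉ
      , extend vs ℓ ((v , f 0ᵉ) ∷ A) S (f ∘ sucᵉ) (f∈L ∘ sucᵉ) (λ i j → proper (sucᵉ i) (sucᵉ j))
          (λ i → (λ (eq , v~i) → proper 0ᵉ (sucᵉ i) v~i (sym eq)) ∷ compatible (sucᵉ i)) n≤ })
      (f∈L 0ᵉ))
    where
    0ᵉ : Elements (inside ∷ S)
    0ᵉ = zero , here
    sucᵉ : Elements S → Elements (inside ∷ S)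
    sucᵉ (i , i∈S) = suc i , there i∈S
  -- With no loss left, `S` would have to contain every position, yet the first is outside.
  extend (v ∷ vs) zero A (outside ∷ S) f f∈L proper compatible n≤ =
    contradiction (≤-trans n≤ (≤-trans (≤-reflexive (+-identityʳ ∣ S ∣)) (∣p∣≤n S))) 1+n≰n
  extend (v ∷ vs) (suc ℓ) A (outside ∷ S) f f∈L proper compatible n≤ =
    inj₂ (extend vs ℓ A S (f ∘ sucᵉ) (f∈L ∘ sucᵉ) (λ i j → proper (sucᵉ i) (sucᵉ j))
      (compatible ∘ sucᵉ) (s≤s⁻¹ (≤-trans n≤ (≤-reflexive (+-suc ∣ S ∣ ℓ)))))
    where
    sucᵉ : Elements S → Elements (outside ∷ S)
    sucᵉ (i , i∈S) = suc i , there i∈S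

-- The graph and its 3-choosability.

edges : List (Fin 14 × Fin 14)
edges =
  (# 2 , # 3)  ∷ (# 2 , # 4)  ∷ (# 3 , # 4)  ∷
  (# 5 , # 6)  ∷ (# 5 , # 7)  ∷ (# 6 , # 7)  ∷
  (# 8 , # 9)  ∷ (# 8 , # 10) ∷ (# 9 , # 10) ∷
  (# 11 , # 12) ∷ (# 11 , # 13) ∷ (# 12 , # 13) ∷
  (# 0 , # 2)  ∷ (# 0 , # 4)  ∷ (# 0 , # 5)  ∷ (# 0 , # 7)  ∷ (# 0 , # 8)  ∷ (# 0 , # 11) ∷ (# 0 , # 12) ∷
  (# 1 , # 2)  ∷ (# 1 , # 4)  ∷ (# 1 , # 5)  ∷ (# 1 , # 7)  ∷ (# 1 , # 8)  ∷ (# 1 , # 10) ∷ (# 1 , # 11) ∷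
  (# 6 , # 10) ∷ (# 6 , # 12) ∷ []

G : Graph (Fin 14)
G = record
  { _~_   = λ u v → (u , v) ∈ˡ edges ⊎ (v , u) ∈ˡ edges
  ; ~-sym = swap
  ; ~-irr = [ loopless , loopless ]′
  ; _~?_  = λ u v → mem? _≟ᵉ_ (u , v) edges ⊎-dec mem? _≟ᵉ_ (v , u) edges
  }
  where
  _≟ᵉ_ = ≡-dec _≟ᶠ_ _≟ᶠ_

  loopless : ∀ {v} → (v , v) ∉ˡ edges
  loopless vv∈ = All.lookup (from-yes (all? (λ (u , v) → ¬? (u ≟ᶠ v)) edges)) vv∈ refl

open Graph G using (_~_)

choosable : Choosable G 3
choosable L
  with c0 , c1 , ∈0 , ∈1 , ∥2 ∷ ∥5 ∷ ∥8 ∷ ∥11 ∷ [] ←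
    harmlessPair (L (# 0)) (L (# 1)) (L (# 2) ∷ L (# 5) ∷ L (# 8) ∷ L (# 11) ∷ []) ≤-refl
  = let
  -- In this order every vertex meets at most two coloured neighbours, except 2, 5, 8 and 11: each
  -- of these meets both hubs and one vertex of its triangle, and there the harmless pair is used.
  c4  , ∈4  , 0≢4  , 1≢4          = avoid₂ (L (# 4)) c0 c1
  c2  , ∈2  , 0≢2  , 1≢2  , 4≢2   = avoid₃ (L (# 2)) c0 c1 c4 ∥2
  c3  , ∈3  , 2≢3  , 4≢3          = avoid₂ (L (# 3)) c2 c4
  c7  , ∈7  , 0≢7  , 1≢7          = avoid₂ (L (# 7)) c0 c1
  c5  , ∈5  , 0≢5  , 1≢5  , 7≢5   = avoid₃ (L (# 5)) c0 c1 c7 ∥5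
  c6  , ∈6  , 5≢6  , 7≢6          = avoid₂ (L (# 6)) c5 c7
  c10 , ∈10 , 1≢10 , 6≢10         = avoid₂ (L (# 10)) c1 c6
  c8  , ∈8  , 0≢8  , 1≢8  , 10≢8  = avoid₃ (L (# 8)) c0 c1 c10 ∥8
  c9  , ∈9  , 8≢9  , 10≢9         = avoid₂ (L (# 9)) c8 c10
  c12 , ∈12 , 0≢12 , 6≢12         = avoid₂ (L (# 12)) c0 c6
  c11 , ∈11 , 0≢11 , 1≢11 , 12≢11 = avoid₃ (L (# 11)) c0 c1 c12 ∥11
  c13 , ∈13 , 11≢13 , 12≢13       = avoid₂ (L (# 13)) c11 c12

  coloured : Allᵛ (λ v → ∃ (_∈ᶜ L v)) (allFin 14)
  coloured = (c0 , ∈0) ∷ (c1 , ∈1) ∷ (c2 , ∈2) ∷ (c3 , ∈3) ∷ (c4 , ∈4) ∷ (c5 , ∈5) ∷ (c6 , ∈6) ∷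
    (c7 , ∈7) ∷ (c8 , ∈8) ∷ (c9 , ∈9) ∷ (c10 , ∈10) ∷ (c11 , ∈11) ∷ (c12 , ∈12) ∷ (c13 , ∈13) ∷ []

  choice : ∀ v → ∃ (_∈ᶜ L v)
  -- `allFin` tabulates `id`, so the resulting function computes at each numeral, as the list
  -- `proper` requires.
  choice = tabulate⁻ {f = id} coloured

  f : Fin 14 → ℕ
  f = proj₁ ∘ choice

  proper : All (λ (u , v) → f u ≢ f v) edges
  proper =
    2≢3 ∷ ≢-sym 4≢2 ∷ ≢-sym 4≢3 ∷
    5≢6 ∷ ≢-sym 7≢5 ∷ ≢-sym 7≢6 ∷
    8≢9 ∷ ≢-sym 10≢8 ∷ ≢-sym 10≢9 ∷
    ≢-sym 12≢11 ∷ 11≢13 ∷ 12≢13 ∷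
    0≢2 ∷ 0≢4 ∷ 0≢5 ∷ 0≢7 ∷ 0≢8 ∷ 0≢11 ∷ 0≢12 ∷
    1≢2 ∷ 1≢4 ∷ 1≢5 ∷ 1≢7 ∷ 1≢8 ∷ 1≢10 ∷ 1≢11 ∷
    6≢10 ∷ 6≢12 ∷ []
  in f
   , proj₂ ∘ choice
   , (λ u v → [ All.lookup proper , ≢-sym ∘ All.lookup proper ]′)

-- The bad lists and the bound 9.

pair : ∀ x y → {x≢y : True (¬? (x ≟ y))} → ColourSet 2
pair x y {x≢y} = x ∷ y ∷ [] , (toWitness x≢y ∷ []) ∷ [] ∷ []

-- The triangle lists are the four sets made of one colour from each hub list, so if both hubs are
-- coloured, their colours form the list of some triangle. In the first two triangles this costs two
-- vertices adjacent to both hubs. In the last two it costs 8 or 11 and, unless a further vertex is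
-- lost, forces 10 or 12 to share its colour with 6.
badLists : ListAssignment (Fin 14) 2
badLists = lookupᵛ
  ( pair 0 2 ∷ pair 1 3
  ∷ pair 0 1 ∷ pair 0 1 ∷ pair 0 1
  ∷ pair 2 3 ∷ pair 2 3 ∷ pair 2 3
  ∷ pair 1 2 ∷ pair 1 2 ∷ pair 1 2
  ∷ pair 0 3 ∷ pair 0 3 ∷ pair 0 3 ∷ [])

open Search G badLists

atMost9 : (S : Subset 14) (f : Elements S → ℕ) →
          IsProperColouring (G [ S ]) (restrict badLists S) f → ∣ S ∣ ≤ 9
atMost9 S f (f∈L , proper) = ≮⇒≥ λ 10≤∣S∣ →
  -- The 4 is 14 - 10: ten coloured vertices would leave at most four losses, which evaluating the
  -- search rules out.
  from-no (extendable? (toList (allFin 14)) 4 [])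
    (extend (allFin 14) 4 [] S f
      (λ i → subst (λ v → f i ∈ᶜ badLists v) (sym (lookup-allFin (proj₁ i))) (f∈L i))
      (λ i j i~j → proper i j (subst₂ _~_ (lookup-allFin (proj₁ i)) (lookup-allFin (proj₁ j)) i~j))
      (λ _ → [])
      (+-monoˡ-≤ 4 10≤∣S∣))

theorem1p1 : Σ (Graph (Fin 14)) λ G →
    IsListChromaticNumber G 3 ×
    Σ (ListAssignment (Fin 14) 2) λ L →
    (S : Subset 14) (f : Elements S → ℕ) →
    IsProperColouring (G [ S ]) (restrict L S) f →
    ∣ S ∣ ≤ 9
theorem1p1 = G , (s≤s z≤n , choosable , 3≤) , badLists , atMost9
  where
  3≤ : ∀ j → 1 ≤ j → Choosable G j → 3 ≤ j
  3≤ 1 _ colouring with colouring (λ _ → 0 ∷ [] , [] ∷ [])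
  ... | f , f∈L , proper with f∈L (# 2) | f∈L (# 3)
  ... | here f2≡0 | here f3≡0 =
    contradiction (trans f2≡0 (sym f3≡0)) (proper (# 2) (# 3) (inj₁ (here refl)))
  -- The same bad lists refute 2-choosability: a full proper colouring would give 14 ≤ 9.
  3≤ 2 _ colouring with colouring badLists
  ... | f , f∈L , proper =
    contradiction (atMost9 full (f ∘ proj₁) ((λ v → f∈L (proj₁ v)) , λ u v → proper (proj₁ u) (proj₁ v)))
      (from-no (14 ≤? 9))
  3≤ (suc (suc (suc j))) _ _ = s≤s (s≤s (s≤s z≤n))
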